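{- The following hold. (1) $\alpha_*(\Sigma^*)=\mathcal Q$ and $\alpha_{\le\omega}(\Sigma^{\le\omega})=\mathcal C$ (top elements are preserved); $\alpha_*(\emptyset)=\emptyset$ and $\alpha_{\le\omega}(\emptyset)=\emptyset$. (2) For $U,U'\subseteq\Sigma^*$ and $V,V'\subseteq\Sigma^{\le\omega}$: $\alpha_*(U\cup U')=\alpha_*(U)\cup\alpha_*(U')$ and $\alpha_{\le\omega}(V\cup V')=\alpha_{\le\omega}(V)\cup\alpha_{\le\omega}(V')$. (3) $\alpha_*(U\cdot U')=\alpha_*(U)\cdot\alpha_*(U')$ and $\alpha_{\le\omega}(U\cdot V)=\alpha_*(U)\cdot\alpha_{\le\omega}(V)$. (4) If $n\ge1$, $\Phi$ is a monotone operator on $\mathcal P(\Sigma^*)^n$, $F$ is a monotone operator on $\mathcal M_*^n$, and $\alpha_*\circ\Phi=F\circ\alpha_*$ (with $\alpha_*$ applied componentwise), then $\alpha_*(\mathrm{lfp}(\Phi))=\mathrm{lfp}(F)$. (5) For every $U\subseteq\Sigma^*$: $\alpha_{\le\omega}(U^\omega)=\alpha_*(U)^\omega$.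
   Context: $\Sigma$ is a finite alphabet, $\Sigma^{\le\omega}=\Sigma^*\cup\Sigma^\omega$; concatenation $w\cdot u$ equals $wu$ if $w$ is finite and $w$ if $w$ is infinite, extended pointwise to languages. For $A\subseteq\Sigma^*$, $A^\omega$ is the set of all words $w_0w_1w_2\cdots$ with $w_i\in A$, and $CD^\omega$ means $C\cdot D^\omega$. Fix an extended Büchi automaton $\mathfrak A=(Q,\Sigma,\delta,q_0,F)$ (finite states, $\delta:Q\times\Sigma\to\mathcal P(Q)$, initial $q_0$, final $F$). For $w\in\Sigma^*$ write $p\overset{w}{\leadsto}q$ if $q$ is reachable from $p$ reading $w$, and $p\overset{w}{\leadsto}_F q$ if there are $q''\in F$, $w=uv$ with $p\overset{u}{\leadsto}q''\overset{v}{\leadsto}q$. For $w,u\in\Sigma^+$, $w\sim u$ iff for all $p,q$: $p\overset{w}{\leadsto}q\Leftrightarrow p\overset{u}{\leadsto}q$ and $p\overset{w}{\leadsto}_Fq\Leftrightarrow p\overset{u}{\leadsto}_Fq$. $\mathcal Q=\Sigma^+/{\sim}\uplus\{[\epsilon]\}$ with $[\epsilon]=\{\epsilon\}$; concatenation of classes is well defined. Let $\mathcal C=\{(C,D)\mid C,D\in\mathcal Q,\ CD=C,\ DD=D\}$. Define $\mathfrak f(V)=\{(C,D)\in\mathcal C\mid CD^\omega\cap V\neq\emptyset\}$ and $\mathfrak g(\mathcal V)=\bigcup_{(C,D)\in\mathcal V}CD^\omega$; closure $\mathfrak c(\mathcal V)=\bigcup_{n\ge1}(\mathfrak f\circ\mathfrak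 g)^n(\mathcal V)$. $\mathcal M_{\le\omega}=\{\mathfrak c(\mathfrak f(V))\mid V\subseteq\Sigma^{\le\omega}\}$, $\mathcal M_*=\mathcal P(\mathcal Q)$, ordered by inclusion. $\alpha_*(U)=\{C\in\mathcal Q\mid C\cap U\neq\emptyset\}$, $\alpha_{\le\omega}(V)=\mathfrak c(\mathfrak f(V))$, $\gamma_*(\mathcal U)=\bigcup_{C\in\mathcal U}C$, $\gamma_{\le\omega}(\mathcal V)=\mathfrak g(\mathcal V)$. Abstract operations: for $\mathcal U,\mathcal U'\in\mathcal M_*$, $\mathcal U\cdot\mathcal U'=\{CC'\mid C\in\mathcal U,C'\in\mathcal U'\}$; for $\mathcal U\in\mathcal M_*$, $\mathcal V\in\mathcal M_{\le\omega}$, $\mathcal U\cdot\mathcal V=\{(AC,D)\mid A\in\mathcal U,(C,D)\in\mathcal V\}$; for $\mathcal U\in\mathcal M_*$, $\mathcal U^\omega:=\alpha_{\le\omega}(\gamma_*(\mathcal U)^\omega)$. -}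

module Defs where

open import Level using (0ℓ)
open import Algebra.Bundles using (Monoid)
open import Data.Empty using (⊥)
open import Data.Fin.Base using (Fin)
open import Data.Fin.Subset as Subset using (Subset)
open import Data.List.Base using (List; []; _∷_; _++_; concat; applyUpTo; length)
open import Data.List.Properties using (++-assoc; ++-identityʳ; ∷-injective)
open import Data.Nat.Base using (ℕ; zero; suc; _≤_)
open import Data.Product.Base using (_×_; _,_; ∃-syntax; proj₁; proj₂)
open import Data.Sum.Base using (_⊎_; inj₁; inj₂; map)
open import Data.Sum.Relation.Binary.Pointwise using (_⊎ₛ_; inj₁; inj₂)
open import Data.Unit.Base using (⊤)
open import Function.Base using (_∘_)
open import Function.Bundles using (_⇔_; mk⇔; Equivalence)
open import Function.Properties.Equivalence using (⇔-isEquivalence)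
open import Relation.Binary.Bundles using (Setoid)
open import Relation.Binary.Definitions using (Monotonic₁; _Respects_)
open import Relation.Binary.PropositionalEquality
  using (_≡_; refl; sym; trans; setoid; _→-setoid_)
open import Relation.Binary.Structures using (IsEquivalence)
open import Relation.Unary using (Pred)

import Function.Endo.Propositional as Endo

record 𝒫 (S : Setoid 0ℓ 0ℓ) : Set₁ where
  open Setoid S
  field
    mem  : Pred Carrier 0ℓ
    resp : mem Respects _≈_

open 𝒫 public

module _ {S : Setoid 0ℓ 0ℓ} where
  open Setoid S using (Carrier)

  infix 4 _∈_ _⊆_ _≐_
  infixr 6 _∪_

  _∈_ : Carrier → 𝒫 S → Set
  x ∈ A = mem A x

  _⊆_ _≐_ : 𝒫 S → 𝒫 S → Set
  A ⊆ B = ∀ x → x ∈ A → x ∈ B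
  A ≐ B = A ⊆ B × B ⊆ A

  ∅ full : 𝒫 S
  ∅    = record { mem = λ _ → ⊥ ; resp = λ _ b → b }
  full = record { mem = λ _ → ⊤ ; resp = λ _ t → t }

  _∪_ : 𝒫 S → 𝒫 S → 𝒫 S
  A ∪ B = record
    { mem  = λ x → x ∈ A ⊎ x ∈ B
    ; resp = λ x≈y → map (resp A x≈y) (resp B x≈y)
    }

module _ {S : Setoid 0ℓ 0ℓ} {n : ℕ} where

  infix 4 _⊑_ _≋_

  _⊑_ _≋_ : (Fin n → 𝒫 S) → (Fin n → 𝒫 S) → Set
  X ⊑ Y = ∀ i → X i ⊆ Y i
  X ≋ Y = ∀ i → X i ≐ Y i

  Monotone : ((Fin n → 𝒫 S) → (Fin n → 𝒫 S)) → Set₁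
  Monotone Φ = Monotonic₁ _⊑_ _⊑_ Φ

  IsLfp : ((Fin n → 𝒫 S) → (Fin n → 𝒫 S)) → (Fin n → 𝒫 S) → Set₁
  IsLfp Φ X = (Φ X ≋ X) × (∀ Y → Φ Y ≋ Y → X ⊑ Y)

module Words (m : ℕ) where

  Word ωWord Word≤ω : Set
  Word   = List (Fin m)
  ωWord  = ℕ → Fin m
  Word≤ω = Word ⊎ ωWord

  -- Without function extensionality, languages of ω-words must be closed under
  -- pointwise equality.

  Σ* Σ≤ω : Setoid 0ℓ 0ℓ
  Σ*  = setoid Word
  Σ≤ω = Σ* ⊎ₛ (ℕ →-setoid Fin m)

  infix 4 _≈ω_ _⇛_

  _≈ω_ : Word≤ω → Word≤ω → Set
  _≈ω_ = Setoid._≈_ Σ≤ω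

  infixr 5 _++ω_ _++≤ω_

  _++ω_ : Word → ωWord → ωWord
  ([]      ++ω s) i       = s i
  ((a ∷ w) ++ω s) zero    = a
  ((a ∷ w) ++ω s) (suc i) = (w ++ω s) i

  _++≤ω_ : Word → Word≤ω → Word≤ω
  w ++≤ω inj₁ u = inj₁ (w ++ u)
  w ++≤ω inj₂ s = inj₂ (w ++ω s)

  prefix : (ℕ → Word) → ℕ → Word
  prefix ws n = concat (applyUpTo ws n)

  -- ws ⇛ x means that x = w₀w₁w₂⋯.  The product is a finite word exactly
  -- when all but finitely many factors are empty, so it is given by its graph
  -- rather than by a function.

  data _⇛_ (ws : ℕ → Word) : Word≤ω → Set where
    finite   : ∀ {w} n → (∀ i → n ≤ i → ws i ≡ []) → w ≡ prefix ws n →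
               ws ⇛ inj₁ w
    infinite : ∀ {s} →
               (∀ n → ∃[ t ] (∀ i → s i ≡ (prefix ws n ++ω t) i)) →
               (∀ l → ∃[ n ] l ≤ length (prefix ws n)) →
               ws ⇛ inj₂ s

  ⇛-resp : ∀ {ws} → (ws ⇛_) Respects _≈ω_
  ⇛-resp (inj₁ refl) (finite n e p)   = finite n e p
  ⇛-resp (inj₂ s≗t)  (infinite p unb) = infinite
    (λ n → proj₁ (p n) , λ i → trans (sym (s≗t i)) (proj₂ (p n) i)) unb

  infixr 7 _·_ _·≤ω_
  infix  8 _^ω

  _·_ : 𝒫 Σ* → 𝒫 Σ* → 𝒫 Σ*
  U · U′ = record
    { mem  = λ w → ∃[ u ] ∃[ u′ ] u ∈ U × u′ ∈ U′ × w ≡ u ++ u′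
    ; resp = λ { refl h → h }
    }

  _·≤ω_ : 𝒫 Σ* → 𝒫 Σ≤ω → 𝒫 Σ≤ω
  U ·≤ω V = record
    { mem  = λ x → ∃[ u ] ∃[ v ] u ∈ U × v ∈ V × x ≈ω u ++≤ω v
    ; resp = λ x≈y (u , v , u∈U , v∈V , x≈uv) →
        u , v , u∈U , v∈V , Setoid.trans Σ≤ω (Setoid.sym Σ≤ω x≈y) x≈uv
    }

  _^ω : 𝒫 Σ* → 𝒫 Σ≤ω
  A ^ω = record
    { mem  = λ x → ∃[ ws ] (∀ i → ws i ∈ A) × ws ⇛ x
    ; resp = λ x≈y (ws , ws∈A , ws⇛x) → ws , ws∈A , ⇛-resp x≈y ws⇛x
    }

record ExtendedBüchi (m : ℕ) : Set where
  field
    states : ℕ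
    δ      : Fin states → Fin m → Subset states
    q₀     : Fin states
    F      : Subset states

module Abstraction {m : ℕ} (𝔄 : ExtendedBüchi m) where

  open Words m public
  open ExtendedBüchi 𝔄

  State : Set
  State = Fin states

  infix 4 _⇝[_]_ _⇝F[_]_ _∼_ _≈_

  data _⇝[_]_ : State → Word → State → Set where
    stop : ∀ {p} → p ⇝[ [] ] p
    step : ∀ {p r q a w} → r Subset.∈ δ p a → r ⇝[ w ] q → p ⇝[ a ∷ w ] q

  _⇝F[_]_ : State → Word → State → Set
  p ⇝F[ w ] q = ∃[ q″ ] ∃[ u ] ∃[ v ]
    q″ Subset.∈ F × w ≡ u ++ v × p ⇝[ u ] q″ × q″ ⇝[ v ] q

  _∼_ : Word → Word → Set
  w ∼ u = ∀ p q → (p ⇝[ w ] q ⇔ p ⇝[ u ] q) × (p ⇝F[ w ] q ⇔ p ⇝F[ u ] q)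

  -- The equality of the quotient 𝒬: the empty word is only related to
  -- itself, non-empty words are related by ∼.

  data _≈_ : Word → Word → Set where
    ε : [] ≈ []
    + : ∀ {a w b u} → a ∷ w ∼ b ∷ u → a ∷ w ≈ b ∷ u

  private
    module ⇔ {ℓ} = IsEquivalence (⇔-isEquivalence {ℓ})

  ≈-refl : ∀ {w} → w ≈ w
  ≈-refl {[]}    = ε
  ≈-refl {_ ∷ _} = + λ _ _ → ⇔.refl , ⇔.refl

  ≈-sym : ∀ {w u} → w ≈ u → u ≈ w
  ≈-sym ε     = ε
  ≈-sym (+ h) = + λ p q → ⇔.sym (proj₁ (h p q)) , ⇔.sym (proj₂ (h p q))

  ≈-trans : ∀ {w u v} → w ≈ u → u ≈ v → w ≈ v
  ≈-trans ε     ε     = ε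
  ≈-trans (+ h) (+ k) = + λ p q →
    ⇔.trans (proj₁ (h p q)) (proj₁ (k p q)) ,
    ⇔.trans (proj₂ (h p q)) (proj₂ (k p q))

  ≈-reflexive : ∀ {w u} → w ≡ u → w ≈ u
  ≈-reflexive refl = ≈-refl

  ≈-isEquivalence : IsEquivalence _≈_
  ≈-isEquivalence = record { refl = ≈-refl ; sym = ≈-sym ; trans = ≈-trans }

  ⇝-++ : ∀ {p r q w u} → p ⇝[ w ] r → r ⇝[ u ] q → p ⇝[ w ++ u ] q
  ⇝-++ stop       y = y
  ⇝-++ (step d x) y = step d (⇝-++ x y)

  ⇝-split : ∀ {p q} w {u} → p ⇝[ w ++ u ] q →
            ∃[ r ] p ⇝[ w ] r × r ⇝[ u ] q
  ⇝-split []      x = _ , stop , x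
  ⇝-split (_ ∷ w) (step d x) with ⇝-split w x
  ... | r , y , z = r , step d y , z

  ⇝F-++ˡ : ∀ {p r q w u} → p ⇝F[ w ] r → r ⇝[ u ] q → p ⇝F[ w ++ u ] q
  ⇝F-++ˡ {u = u} (f , w₁ , w₂ , f∈F , refl , x , y) z =
    f , w₁ , w₂ ++ u , f∈F , ++-assoc w₁ w₂ u , x , ⇝-++ y z

  ⇝F-++ʳ : ∀ {p r q w u} → p ⇝[ w ] r → r ⇝F[ u ] q → p ⇝F[ w ++ u ] q
  ⇝F-++ʳ {w = w} x (f , u₁ , u₂ , f∈F , refl , y , z) =
    f , w ++ u₁ , u₂ , f∈F , sym (++-assoc w u₁ u₂) , ⇝-++ x y , z

  ⇝F-step : ∀ {p r q a w} → r Subset.∈ δ p a → r ⇝F[ w ] q → p ⇝F[ a ∷ w ] q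
  ⇝F-step d (f , w₁ , w₂ , f∈F , refl , x , y) =
    f , _ ∷ w₁ , w₂ , f∈F , refl , step d x , y

  ⇝F-split : ∀ {p q} w {u} → p ⇝F[ w ++ u ] q →
             (∃[ r ] p ⇝F[ w ] r × r ⇝[ u ] q) ⊎
             (∃[ r ] p ⇝[ w ] r × r ⇝F[ u ] q)
  ⇝F-split []      x = inj₂ (_ , stop , x)
  ⇝F-split (a ∷ w) (f , [] , _ , f∈F , refl , stop , y) with ⇝-split (a ∷ w) y
  ... | r , y₁ , y₂ = inj₁ (r , (f , [] , a ∷ w , f∈F , refl , stop , y₁) , y₂)
  ⇝F-split (a ∷ w) (f , _ ∷ w₁ , w₂ , f∈F , eq , step d x , y) with ∷-injective eq
  ... | refl , eq′ with ⇝F-split w (f , w₁ , w₂ , f∈F , eq′ , x , y)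
  ... | inj₁ (r , z , z′) = inj₁ (r , ⇝F-step d z , z′)
  ... | inj₂ (r , z , z′) = inj₂ (r , step d z , z′)

  ∼-sym : ∀ {w u} → w ∼ u → u ∼ w
  ∼-sym h p q = ⇔.sym (proj₁ (h p q)) , ⇔.sym (proj₂ (h p q))

  ∼-++ : ∀ {w w′ u u′} → w ∼ w′ → u ∼ u′ → w ++ u ∼ w′ ++ u′
  ∼-++ h k p q =
    mk⇔ (run h k) (run (∼-sym h) (∼-sym k)) ,
    mk⇔ (runF h k) (runF (∼-sym h) (∼-sym k))
    where
    open Equivalence using (to)

    run : ∀ {w w′ u u′ p q} → w ∼ w′ → u ∼ u′ →
          p ⇝[ w ++ u ] q → p ⇝[ w′ ++ u′ ] q
    run {w} h k x with ⇝-split w x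
    ... | _ , y , z = ⇝-++ (to (proj₁ (h _ _)) y) (to (proj₁ (k _ _)) z)

    runF : ∀ {w w′ u u′ p q} → w ∼ w′ → u ∼ u′ →
           p ⇝F[ w ++ u ] q → p ⇝F[ w′ ++ u′ ] q
    runF {w} h k x with ⇝F-split w x
    ... | inj₁ (_ , y , z) = ⇝F-++ˡ (to (proj₂ (h _ _)) y) (to (proj₁ (k _ _)) z)
    ... | inj₂ (_ , y , z) = ⇝F-++ʳ (to (proj₁ (h _ _)) y) (to (proj₂ (k _ _)) z)

  ++-cong : ∀ {w w′ u u′} → w ≈ w′ → u ≈ u′ → w ++ u ≈ w′ ++ u′
  ++-cong ε k = k
  ++-cong {w = w} {w′ = w′} (+ h) ε
    rewrite ++-identityʳ w | ++-identityʳ w′ = + h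
  ++-cong (+ h) (+ k) = + (∼-++ h k)

  -- 𝒬 is a setoid quotient: a class is given by a representative word.

  𝒬-monoid : Monoid 0ℓ 0ℓ
  𝒬-monoid = record
    { Carrier  = Word
    ; _≈_      = _≈_
    ; _∙_      = _++_
    ; ε        = []
    ; isMonoid = record
      { isSemigroup = record
        { isMagma = record { isEquivalence = ≈-isEquivalence ; ∙-cong = ++-cong }
        ; assoc   = λ w u v → ≈-reflexive (++-assoc w u v)
        }
      ; identity = (λ _ → ≈-refl) , (λ w → ≈-reflexive (++-identityʳ w))
      }
    }

  𝒬 : Setoid 0ℓ 0ℓ
  𝒬 = Monoid.setoid 𝒬-monoid

  open Monoid 𝒬-monoid using (_∙_) renaming (Carrier to Class) public

  ⟦_⟧ : Class → 𝒫 Σ*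
  ⟦ C ⟧ = record { mem = λ w → w ≈ C ; resp = λ { refl h → h } }

  record LinkedPair : Set where
    constructor linked
    field
      fst snd : Class
      CD=C    : fst ∙ snd ≈ fst
      DD=D    : snd ∙ snd ≈ snd

  open LinkedPair public using (fst; snd)

  _≈₂_ : LinkedPair → LinkedPair → Set
  P ≈₂ P′ = fst P ≈ fst P′ × snd P ≈ snd P′

  𝒞 : Setoid 0ℓ 0ℓ
  𝒞 = record
    { Carrier       = LinkedPair
    ; _≈_           = _≈₂_
    ; isEquivalence = record
      { refl  = ≈-refl , ≈-refl
      ; sym   = λ (h , k) → ≈-sym h , ≈-sym k
      ; trans = λ (h , k) (h′ , k′) → ≈-trans h h′ , ≈-trans k k′
      }
    }

  -- ⟦ (C , D) ⟧ω is CD^ω.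

  ⟦_⟧ω : LinkedPair → 𝒫 Σ≤ω
  ⟦ P ⟧ω = ⟦ fst P ⟧ ·≤ω ⟦ snd P ⟧ ^ω

  ⟦⟧ω-cong : ∀ P P′ → P ≈₂ P′ → ⟦ P ⟧ω ⊆ ⟦ P′ ⟧ω
  ⟦⟧ω-cong _ _ (h , k) _ (c , v , c∈C , (ds , ds∈D , ds⇛v) , x≈cv) =
    c , v , ≈-trans c∈C h , (ds , (λ i → ≈-trans (ds∈D i) k) , ds⇛v) , x≈cv

  𝔣 : 𝒫 Σ≤ω → 𝒫 𝒞
  𝔣 V = record
    { mem  = λ P → ∃[ x ] x ∈ ⟦ P ⟧ω × x ∈ V
    ; resp = λ {P} {P′} P≈P′ (x , x∈P , x∈V) →
        x , ⟦⟧ω-cong P P′ P≈P′ x x∈P , x∈V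
    }

  𝔤 : 𝒫 𝒞 → 𝒫 Σ≤ω
  𝔤 𝒱 = record
    { mem  = λ x → ∃[ P ] P ∈ 𝒱 × x ∈ ⟦ P ⟧ω
    ; resp = λ x≈y (P , P∈𝒱 , x∈P) → P , P∈𝒱 , resp ⟦ P ⟧ω x≈y x∈P
    }

  𝔠 : 𝒫 𝒞 → 𝒫 𝒞
  𝔠 𝒱 = record
    { mem  = λ P → ∃[ n ] 1 ≤ n × P ∈ ((𝔣 ∘ 𝔤) ^ n) 𝒱
    ; resp = λ P≈P′ (n , 1≤n , P∈) → n , 1≤n , resp (((𝔣 ∘ 𝔤) ^ n) 𝒱) P≈P′ P∈
    }
    where open Endo (𝒫 𝒞) using (_^_)

  M* : Set₁
  M* = 𝒫 𝒬

  record M≤ω : Set₁ where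
    field
      pairs  : 𝒫 𝒞
      closed : ∃[ V ] pairs ≐ 𝔠 (𝔣 V)

  open M≤ω public using (pairs)

  α* : 𝒫 Σ* → M*
  α* U = record
    { mem  = λ C → ∃[ w ] w ∈ ⟦ C ⟧ × w ∈ U
    ; resp = λ C≈C′ (w , w∈C , w∈U) → w , ≈-trans w∈C C≈C′ , w∈U
    }

  α≤ω : 𝒫 Σ≤ω → M≤ω
  α≤ω V = record
    { pairs  = 𝔠 (𝔣 V)
    ; closed = V , (λ _ h → h) , (λ _ h → h)
    }

  γ* : M* → 𝒫 Σ*
  γ* 𝒰 = record
    { mem  = λ w → ∃[ C ] C ∈ 𝒰 × w ∈ ⟦ C ⟧
    ; resp = λ { refl h → h }
    }

  infixr 7 _·♯_ _·♯≤ω_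
  infix  8 _^ω♯

  _·♯_ : M* → M* → M*
  𝒰 ·♯ 𝒰′ = record
    { mem  = λ X → ∃[ C ] ∃[ C′ ] C ∈ 𝒰 × C′ ∈ 𝒰′ × X ≈ C ∙ C′
    ; resp = λ X≈Y (C , C′ , h , h′ , eq) →
        C , C′ , h , h′ , ≈-trans (≈-sym X≈Y) eq
    }

  -- (A C , D) is again a linked pair, by associativity.  The result is a
  -- subset of 𝒞; that it lies in M≤ω is not part of the definition.

  act : Class → LinkedPair → LinkedPair
  act A (linked C D CD=C DD=D) = linked (A ∙ C) D
    (≈-trans (≈-reflexive (++-assoc A C D)) (++-cong (≈-refl {A}) CD=C)) DD=D

  _·♯≤ω_ : M* → M≤ω → 𝒫 𝒞
  𝒰 ·♯≤ω 𝒱 = record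
    { mem  = λ P → ∃[ A ] ∃[ P′ ] A ∈ 𝒰 × P′ ∈ pairs 𝒱 × P ≈₂ act A P′
    ; resp = λ (C≈ , D≈) (A , P′ , h , h′ , C≈′ , D≈′) →
        A , P′ , h , h′ , ≈-trans (≈-sym C≈) C≈′ , ≈-trans (≈-sym D≈) D≈′
    }

  _^ω♯ : M* → M≤ω
  𝒰 ^ω♯ = α≤ω (γ* 𝒰 ^ω)

{-# OPTIONS --safe #-}

-- Everything rests on two facts about a linked pair (C , D).
--
-- Cutting: if u v ∈ CD^ω with u finite, then (C , D) = ([u]C′ , D) for a linked
-- pair (C′ , D) with v ∈ C′D^ω.  Hence membership in CD^ω is insensitive to
-- replacing a finite prefix by an equivalent word, and 𝔣, 𝔣 ∘ 𝔤 commute with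
-- the left action of classes, which is (3).
--
-- Ramsey: for a sequence w₀, w₁, … there is a linked pair (C , D) such that CD^ω
-- contains every product u₀u₁⋯ with uᵢ ≈ wᵢ.  So a word of γ*(α*(U))^ω and a word
-- of U^ω always lie in a common CD^ω; thus one more round of 𝔣 ∘ 𝔤 leads from
-- 𝔣(U^ω) to 𝔣(γ*(α*(U))^ω), which is (5).
--
-- For (4), α* is left adjoint to γ*, so γ*(lfp F) is a pre-fixed point of Φ and
-- α*(lfp Φ) a fixed point of F.

module Submission where

open import Level using (0ℓ; lift; lower) renaming (suc to lsuc)
open import Axiom.ExcludedMiddle using (ExcludedMiddle)
open import Data.Empty using (⊥-elim)
open import Data.Fin.Base using (Fin; zero; suc)
open import Data.List.Base using ([]; _∷_; _++_; length)
open import Data.List.Properties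
  using (++-assoc; ++-identityʳ; ++-identityʳ-unique; ++-cancelˡ; length-++; length-++-≤ˡ)
open import Data.Nat.Base
  using (ℕ; zero; suc; _+_; _∸_; _⊔_; _≤_; _<_; z≤n; s≤s)
open import Data.Nat.Properties
open import Data.Product.Base using (_×_; _,_; ∃-syntax; proj₁; proj₂)
open import Data.Sum.Base as Sum using (inj₁; inj₂)
import Data.Sum.Relation.Binary.Pointwise as Pointwise
open import Data.Unit.Base using (⊤; tt)
open import Function.Base using (_∘_; id)
open import Function.Bundles using (_⇔_; mk⇔; Equivalence)
import Function.Endo.Propositional as Endo
open import Relation.Binary.Bundles using (Setoid)
open import Relation.Binary.PropositionalEquality
  using (_≡_; _≢_; _≗_; refl; sym; trans; cong; subst; module ≡-Reasoning)
open import Relation.Nullary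
  using (¬_; yes; no; True; toWitness; fromWitness; decidable-stable)
open import Relation.Nullary.Decidable using (map′)
open import Relation.Unary using (Pred)
open import Defs

lower-em : ExcludedMiddle (lsuc 0ℓ) → ExcludedMiddle 0ℓ
lower-em em = map′ lower (lift {ℓ = lsuc 0ℓ}) em

-- Least fixed points

module KnasterTarski (em : ExcludedMiddle (lsuc 0ℓ)) {S : Setoid 0ℓ 0ℓ} {n : ℕ}
  (Φ : (Fin n → 𝒫 S) → (Fin n → 𝒫 S)) (Φ-mono : Monotone Φ) where

  -- Excluded middle resizes the impredicative intersection of all pre-fixed
  -- points from Set₁ to Set.
  lfp : Fin n → 𝒫 S
  lfp i = record
    { mem  = λ x → True (em {∀ Y → Φ Y ⊑ Y → x ∈ Y i})
    ; resp = λ x≈y x∈ → fromWitness λ Y pre →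
        resp (Y i) x≈y (toWitness x∈ Y pre)
    }

  lfp-least : ∀ Y → Φ Y ⊑ Y → lfp ⊑ Y
  lfp-least Y pre i x x∈ = toWitness x∈ Y pre

  lfp-pre : Φ lfp ⊑ lfp
  lfp-pre i x x∈ = fromWitness λ Y pre →
    pre i x (Φ-mono (lfp-least Y pre) i x x∈)

  lfp-post : lfp ⊑ Φ lfp
  lfp-post = lfp-least (Φ lfp) (Φ-mono lfp-pre)

  lfp-isLfp : IsLfp Φ lfp
  lfp-isLfp =
    (λ i → lfp-pre i , lfp-post i) , λ Y fix → lfp-least Y (proj₁ ∘ fix)

  -- `IsLfp` compares `X` with fixed points only; the passage to pre-fixed points goes through
  -- `lfp`, a fixed point below all of them.
  isLfp-least-pre : ∀ {X} → IsLfp Φ X → ∀ Y → Φ Y ⊑ Y → X ⊑ Y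
  isLfp-least-pre (_ , least) Y pre i x x∈ =
    lfp-least Y pre i x (least lfp (proj₁ lfp-isLfp) i x x∈)

-- Ramsey's theorem

Unbounded : Pred ℕ 0ℓ → Set
Unbounded A = ∀ n → ∃[ k ] n ≤ k × A k

Increasing : (ℕ → ℕ) → Set
Increasing h = ∀ {i j} → i < j → h i < h j

increasing⇒≤ : ∀ {h} → Increasing h → ∀ {i j} → i ≤ j → h i ≤ h j
increasing⇒≤ inc i≤j with m≤n⇒m<n∨m≡n i≤j
... | inj₁ i<j  = <⇒≤ (inc i<j)
... | inj₂ refl = ≤-refl

increasing⇒inflationary : ∀ {h} → Increasing h → ∀ n → n ≤ h n
increasing⇒inflationary inc zero    = z≤n
increasing⇒inflationary inc (suc n) =
  ≤-<-trans (increasing⇒inflationary inc n) (inc (n<1+n n))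

-- One implication is enough to make the range of `h` monochromatic, since the two pairs can be
-- exchanged.
Homogeneous : (ℕ → ℕ → Set) → (ℕ → ℕ) → Set
Homogeneous R h = ∀ {i j k l} → i < j → k < l → R (h i) (h j) → R (h k) (h l)

-- A family of relations encodes a colouring of pairs: the colour is the set of indices whose
-- relation holds.
Ramsey : Set → Set₁
Ramsey I = (R : I → ℕ → ℕ → Set) →
  ∃[ h ] Increasing h × (∀ i → Homogeneous (R i) h)

Later : (ℕ → ℕ → Set) → Pred ℕ 0ℓ → ℕ → Pred ℕ 0ℓ
Later Q A a c = A c × a < c × Q a c

-- Each choice shrinks the reservoir to the later `Q`-neighbours of the chosen element, so all
-- further choices are `Q`-related to it.
module Chain (Q : ℕ → ℕ → Set) (B : Pred ℕ 0ℓ) (B-unbounded : Unbounded B)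
  (extend : ∀ A → Unbounded A → (∀ {a} → A a → B a) →
            ∃[ a ] A a × Unbounded (Later Q A a))
  where

  record Reservoir : Set₁ where
    field
      set       : Pred ℕ 0ℓ
      unbounded : Unbounded set
      inside    : ∀ {a} → set a → B a

    chosen : ∃[ a ] set a × Unbounded (Later Q set a)
    chosen = extend set unbounded inside

  open Reservoir

  reservoir : ℕ → Reservoir
  reservoir zero    = record { set = B ; unbounded = B-unbounded ; inside = id }
  reservoir (suc n) = record
    { set       = Later Q (set r) (proj₁ (chosen r))
    ; unbounded = proj₂ (proj₂ (chosen r))
    ; inside    = inside r ∘ proj₁
    }
    where r = reservoir n

  chain : ℕ → ℕ
  chain n = proj₁ (chosen (reservoir n))

  reservoir-shrinks : ∀ i d {a} → set (reservoir (d + i)) a → set (reservoir i) a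
  reservoir-shrinks i zero    x = x
  reservoir-shrinks i (suc d) x = reservoir-shrinks i d (proj₁ x)

  chain-later : ∀ {i j} → i < j → chain i < chain j × Q (chain i) (chain j)
  chain-later {i} {j} i<j = proj₂ (reservoir-shrinks (suc i) (j ∸ suc i)
    (subst (λ k → set (reservoir k) (chain j)) (sym (m∸n+n≡m i<j))
      (proj₁ (proj₂ (chosen (reservoir j))))))

module _ (em : ExcludedMiddle (lsuc 0ℓ)) where

  private
    em₀ : ExcludedMiddle 0ℓ
    em₀ = lower-em em

  ¬unbounded⇒bounded : ∀ {A} → ¬ Unbounded A → ∃[ b ] (∀ c → b ≤ c → ¬ A c)
  ¬unbounded⇒bounded {A} ¬unb = decidable-stable em₀ λ ¬bounded →
    ¬unb λ n → decidable-stable em₀ λ none →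
      ¬bounded (n , λ c n≤c c∈A → none (c , n≤c , c∈A))

  -- Either every unbounded set has an element with unboundedly many later
  -- R-neighbours, or some unbounded set has none, and then every element of
  -- each unbounded subset has unboundedly many later non-neighbours.
  ramsey-⊤ : Ramsey ⊤
  ramsey-⊤ R
    with em {∃[ B ] Unbounded B × (∀ a → B a → ¬ Unbounded (Later (R tt) B a))}
  ... | no ¬thin = chain , proj₁ ∘ chain-later , λ _ _ k<l _ → proj₂ (chain-later k<l)
    where
    everything : Unbounded (λ _ → ⊤)
    everything n = n , ≤-refl , tt

    extend : ∀ A → Unbounded A → (∀ {a} → A a → ⊤) →
             ∃[ a ] A a × Unbounded (Later (R tt) A a)
    extend A unb _ = decidable-stable em₀ λ none →
      ¬thin (A , unb , λ a a∈A unb′ → none (a , a∈A , unb′))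

    open Chain (R tt) (λ _ → ⊤) everything extend
  ... | yes (B , B-unb , thin) = chain , proj₁ ∘ chain-later ,
    λ _ i<j _ r → ⊥-elim (proj₂ (chain-later i<j) r)
    where
    extend : ∀ A → Unbounded A → (∀ {a} → A a → B a) →
             ∃[ a ] A a × Unbounded (Later (λ a c → ¬ R tt a c) A a)
    extend A unb A⊆B =
      let (a , _ , a∈A) = unb 0
          (b , bounded) = ¬unbounded⇒bounded (thin a (A⊆B a∈A))
      in a , a∈A , λ n →
        -- Beyond `n` as demanded, beyond `a` to be later, and beyond `b`, where `B` has no later
        -- neighbours of `a` left.
        let (c , ≤c , c∈A) = unb (n ⊔ (b ⊔ suc a))
            b⊔a≤c = m⊔n≤o⇒n≤o n _ ≤c
            a<c   = m⊔n≤o⇒n≤o b _ b⊔a≤c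
        in c , m⊔n≤o⇒m≤o n _ ≤c , c∈A , a<c ,
           λ r → bounded c (m⊔n≤o⇒m≤o b _ b⊔a≤c) (A⊆B c∈A , a<c , r)

    open Chain (λ a c → ¬ R tt a c) B B-unb extend

  -- Homogeneity survives passing to a subsequence, so the relations are treated block by block,
  -- each along the sequence found for the blocks before.
  ramsey-Fin× : ∀ {I} → Ramsey I → ∀ n → Ramsey (Fin n × I)
  ramsey-Fin× _      zero    R = id , id , λ ()
  ramsey-Fin× ramsey (suc n) R =
    let (h , h-inc , h-hom) = ramsey λ i → R (zero , i)
        (k , k-inc , k-hom) =
          ramsey-Fin× ramsey n λ (p , i) a b → R (suc p , i) (h a) (h b)
    in h ∘ k , h-inc ∘ k-inc , λ
      { (zero  , i) a<b c<d → h-hom i (k-inc a<b) (k-inc c<d)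
      ; (suc p , i)         → k-hom (p , i)
      }

-- Products of sequences of words

module _ {m : ℕ} where

  open Words m
  open ≡-Reasoning

  module ≈ω = Setoid Σ≤ω

  ++ω-cong : ∀ w {s t} → s ≗ t → w ++ω s ≗ w ++ω t
  ++ω-cong []      eq i       = eq i
  ++ω-cong (a ∷ w) eq zero    = refl
  ++ω-cong (a ∷ w) eq (suc i) = ++ω-cong w eq i

  ++ω-assoc : ∀ w u s → (w ++ u) ++ω s ≗ w ++ω u ++ω s
  ++ω-assoc []      u s i       = refl
  ++ω-assoc (a ∷ w) u s zero    = refl
  ++ω-assoc (a ∷ w) u s (suc i) = ++ω-assoc w u s i

  ++ω-cancel : ∀ w {s t} → w ++ω s ≗ w ++ω t → s ≗ t
  ++ω-cancel []      eq = eq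
  ++ω-cancel (a ∷ w) eq = ++ω-cancel w (eq ∘ suc)

  ++ω-indifferent : ∀ w {s t i} → i < length w → (w ++ω s) i ≡ (w ++ω t) i
  ++ω-indifferent (a ∷ w) {i = zero}  _         = refl
  ++ω-indifferent (a ∷ w) {i = suc i} (s≤s i<w) = ++ω-indifferent w i<w

  ++ω-rest : ∀ w {r s} → (∀ i → i < length w → s i ≡ (w ++ω r) i) →
             s ≗ w ++ω λ j → s (length w + j)
  ++ω-rest []      eq i       = refl
  ++ω-rest (a ∷ w) eq zero    = eq 0 (s≤s z≤n)
  ++ω-rest (a ∷ w) eq (suc i) = ++ω-rest w (λ j j<w → eq (suc j) (s≤s j<w)) i

  ++ω-comparable : ∀ u p {s t} → length u ≤ length p → u ++ω s ≗ p ++ω t →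
                   ∃[ r ] p ≡ u ++ r
  ++ω-comparable []      p       _         _  = p , refl
  ++ω-comparable (a ∷ u) (b ∷ p) (s≤s u≤p) eq
    with refl ← eq 0 | r , refl ← ++ω-comparable u p u≤p (eq ∘ suc) = r , refl

  ++≤ω-cong : ∀ w {x y} → x ≈ω y → w ++≤ω x ≈ω w ++≤ω y
  ++≤ω-cong w (Pointwise.inj₁ refl) = ≈ω.refl
  ++≤ω-cong w (Pointwise.inj₂ eq)   = Pointwise.inj₂ (++ω-cong w eq)

  ++≤ω-assoc : ∀ w u x → (w ++ u) ++≤ω x ≈ω w ++≤ω u ++≤ω x
  ++≤ω-assoc w u (inj₁ v) = Pointwise.inj₁ (++-assoc w u v)
  ++≤ω-assoc w u (inj₂ s) = Pointwise.inj₂ (++ω-assoc w u s)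

  ++≤ω-cancel : ∀ w x y → w ++≤ω x ≈ω w ++≤ω y → x ≈ω y
  ++≤ω-cancel w (inj₁ u) (inj₁ v) (Pointwise.inj₁ eq) =
    Pointwise.inj₁ (++-cancelˡ w u v eq)
  ++≤ω-cancel w (inj₂ s) (inj₂ t) (Pointwise.inj₂ eq) =
    Pointwise.inj₂ (++ω-cancel w eq)

  prefix-suc : ∀ ws n → prefix ws (suc n) ≡ prefix ws n ++ ws n
  prefix-suc ws zero    = ++-identityʳ (ws 0)
  prefix-suc ws (suc n) = begin
    ws 0 ++ prefix (ws ∘ suc) (suc n)          ≡⟨ cong (ws 0 ++_) (prefix-suc (ws ∘ suc) n) ⟩
    ws 0 ++ prefix (ws ∘ suc) n ++ ws (suc n)  ≡⟨ ++-assoc (ws 0) _ _ ⟨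
    prefix ws (suc n) ++ ws (suc n)            ∎

  prefix-+ : ∀ ws n k → prefix ws (n + k) ≡ prefix ws n ++ prefix (ws ∘ (n +_)) k
  prefix-+ ws zero    k = refl
  prefix-+ ws (suc n) k =
    trans (cong (ws 0 ++_) (prefix-+ (ws ∘ suc) n k)) (sym (++-assoc (ws 0) _ _))

  prefix-empty : ∀ {ws} → (∀ i → ws i ≡ []) → ∀ n → prefix ws n ≡ []
  prefix-empty e zero    = refl
  prefix-empty e (suc n) rewrite e 0 = prefix-empty (e ∘ suc) n

  segment : (ℕ → Word) → ℕ → ℕ → Word
  segment ws i j = prefix (ws ∘ (i +_)) (j ∸ i)

  prefix-segment : ∀ ws {i j} → i ≤ j → prefix ws i ++ segment ws i j ≡ prefix ws j
  prefix-segment ws {i} {j} i≤j =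
    trans (sym (prefix-+ ws i (j ∸ i))) (cong (prefix ws) (m+[n∸m]≡n i≤j))

  -- Prepending `prefix ws i` turns both sides into `prefix ws k`, and cancels.
  segment-++ : ∀ ws {i j k} → i ≤ j → j ≤ k →
               segment ws i j ++ segment ws j k ≡ segment ws i k
  segment-++ ws {i} {j} {k} i≤j j≤k = ++-cancelˡ (prefix ws i) _ _ (begin
    prefix ws i ++ segment ws i j ++ segment ws j k    ≡⟨ ++-assoc (prefix ws i) _ _ ⟨
    (prefix ws i ++ segment ws i j) ++ segment ws j k  ≡⟨ cong (_++ segment ws j k) (prefix-segment ws i≤j) ⟩
    prefix ws j ++ segment ws j k                      ≡⟨ prefix-segment ws j≤k ⟩
    prefix ws k                                        ≡⟨ prefix-segment ws (≤-trans i≤j j≤k) ⟨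
    prefix ws i ++ segment ws i k                      ∎)

  prefix-stable : ∀ {ws n} → (∀ i → n ≤ i → ws i ≡ []) →
                  ∀ {j} → n ≤ j → prefix ws j ≡ prefix ws n
  prefix-stable {ws} {n} e {j} n≤j = begin
    prefix ws j                    ≡⟨ prefix-segment ws n≤j ⟨
    prefix ws n ++ segment ws n j  ≡⟨ cong (prefix ws n ++_) (prefix-empty (λ i → e (n + i) (m≤m+n n i)) (j ∸ n)) ⟩
    prefix ws n ++ []              ≡⟨ ++-identityʳ _ ⟩
    prefix ws n                    ∎

  length-prefix-mono : ∀ ws {i j} → i ≤ j → length (prefix ws i) ≤ length (prefix ws j)
  length-prefix-mono ws {i} i≤j =
    subst (λ w → length (prefix ws i) ≤ length w) (prefix-segment ws i≤j)
      (length-++-≤ˡ (prefix ws i))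

  ⇛-cons : ∀ {ws x} → (ws ∘ suc) ⇛ x → ws ⇛ (ws 0 ++≤ω x)
  ⇛-cons {ws} (finite n e refl) = finite (suc n) (λ { (suc i) (s≤s n≤i) → e i n≤i }) refl
  ⇛-cons {ws} (infinite {s} pre unb) = infinite
    (λ { zero    → ws 0 ++ω s , λ i → refl
       ; (suc n) → proj₁ (pre n) , λ i →
           trans (++ω-cong (ws 0) (proj₂ (pre n)) i) (sym (++ω-assoc (ws 0) _ _ i)) })
    (λ l → let (n , l≤) = unb l in
      suc n , ≤-trans l≤ (subst (length (prefix (ws ∘ suc) n) ≤_)
        (sym (length-++ (ws 0))) (m≤n+m _ _)))

  ⇛-uncons : ∀ {ws x} → ws ⇛ x → ∃[ y ] x ≈ω ws 0 ++≤ω y × (ws ∘ suc) ⇛ y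
  ⇛-uncons {ws} (finite n e refl) =
    inj₁ (prefix (ws ∘ suc) n) ,
    Pointwise.inj₁ (sym (prefix-stable e (n≤1+n n))) ,
    finite n (λ i n≤i → e (suc i) (m≤n⇒m≤1+n n≤i)) refl
  ⇛-uncons {ws} (infinite {s} pre unb) =
    inj₂ t , Pointwise.inj₂ s≗ ,
    infinite
      (λ n → let (t′ , eq) = pre (suc n) in
        t′ , ++ω-cancel (ws 0) λ i →
          trans (sym (s≗ i)) (trans (eq i) (++ω-assoc (ws 0) _ t′ i)))
      (λ l → let (n , ≤n) = unb (length (ws 0) + l) in
        n , +-cancelˡ-≤ (length (ws 0)) _ _
          (≤-trans ≤n (subst (length (prefix ws n) ≤_) (length-++ (ws 0))
            (length-prefix-mono ws (n≤1+n n)))))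
    where
    t = proj₁ (pre 1)

    s≗ : s ≗ ws 0 ++ω t
    s≗ i = trans (proj₂ (pre 1) i) (cong (λ w → (w ++ω t) i) (++-identityʳ (ws 0)))

  ⇛-split : ∀ n {ws x} → ws ⇛ x →
            ∃[ y ] x ≈ω prefix ws n ++≤ω y × (ws ∘ (n +_)) ⇛ y
  ⇛-split zero    {x = inj₁ _} ws⇛x = _ , ≈ω.refl , ws⇛x
  ⇛-split zero    {x = inj₂ _} ws⇛x = _ , Pointwise.inj₂ (λ _ → refl) , ws⇛x
  ⇛-split (suc n) {ws}         ws⇛x =
    let (y , x≈ , rest⇛y) = ⇛-uncons ws⇛x
        (z , y≈ , rest⇛z) = ⇛-split n rest⇛y
    in z , ≈ω.trans x≈ (≈ω.trans (++≤ω-cong (ws 0) y≈)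
             (≈ω.sym (++≤ω-assoc (ws 0) _ z))) , rest⇛z

  -- Bracketing does not change a product; a bracketing is described by the end points `h n` of its
  -- blocks. The bound `n ≤ h n` transfers both eventual emptiness and unbounded length.
  ⇛-regroup : ∀ {ws zs x} (h : ℕ → ℕ) → (∀ n → n ≤ h n) →
              (∀ n → prefix zs n ≡ prefix ws (h n)) → ws ⇛ x → zs ⇛ x
  ⇛-regroup {ws} {zs} h n≤h eq (finite {w} n e refl) =
    finite n empty (sym (stable ≤-refl))
    where
    stable : ∀ {i} → n ≤ i → prefix zs i ≡ w
    stable {i} n≤i = trans (eq i) (prefix-stable e (≤-trans n≤i (n≤h i)))

    empty : ∀ i → n ≤ i → zs i ≡ []
    empty i n≤i = ++-identityʳ-unique (prefix zs i) (begin
      prefix zs i          ≡⟨ stable n≤i ⟩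
      w                    ≡⟨ stable (m≤n⇒m≤1+n n≤i) ⟨
      prefix zs (suc i)    ≡⟨ prefix-suc zs i ⟩
      prefix zs i ++ zs i  ∎)
  ⇛-regroup {ws} {zs} h n≤h eq (infinite {s} pre unb) = infinite
    (λ n → subst (λ p → ∃[ t ] s ≗ p ++ω t) (sym (eq n)) (pre (h n)))
    (λ l → let (n , l≤) = unb l in
      n , subst (λ p → l ≤ length p) (sym (eq n))
            (≤-trans l≤ (length-prefix-mono ws (n≤h n))))

  -- In the infinite case a prefix at least as long as `u` begins the same ω-word as `u` and hence
  -- extends it; in the finite case the whole product does.
  ⇛-covers : ∀ {ws} u v → ws ⇛ (u ++≤ω v) → ∃[ n ] ∃[ t ] prefix ws n ≡ u ++ t
  ⇛-covers u (inj₁ v) (finite n _ eq) = n , v , sym eq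
  ⇛-covers {ws} u (inj₂ s) (infinite pre unb) =
    let (n , u≤) = unb (length u)
    in n , ++ω-comparable u (prefix ws n) u≤ (proj₂ (pre n))

  prefix-agree : ∀ ws k n {r i} → i < length (prefix ws k) → i < length (prefix ws n) →
                 (prefix ws k ++ω r) i ≡ (prefix ws n ++ω r) i
  prefix-agree ws k n {r} {i} i<k i<n =
    trans (extend k n i<k)
      (trans (cong (λ l → (prefix ws l ++ω r) i) (+-comm k n)) (sym (extend n k i<n)))
    where
    extend : ∀ k n → i < length (prefix ws k) →
             (prefix ws k ++ω r) i ≡ (prefix ws (k + n) ++ω r) i
    extend k n i<k rewrite prefix-+ ws k n =
      trans (++ω-indifferent (prefix ws k) i<k) (sym (++ω-assoc (prefix ws k) _ r i))

  -- The letter at position `i` is read off a prefix longer than `i`; by `prefix-agree` the choice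
  -- of that prefix does not matter.
  unbounded⇒⇛ : ∀ {ws} → (∀ l → ∃[ n ] l ≤ length (prefix ws n)) → ∃[ x ] ws ⇛ x
  -- A non-empty prefix is opened to obtain a letter, as `Fin m` might be empty.
  unbounded⇒⇛ {ws} unb with unb 1
  ... | n₁ , 1≤ with prefix ws n₁
  ...   | a ∷ _ = inj₂ s , infinite
    (λ n → _ , ++ω-rest (prefix ws n) λ i i<n →
      prefix-agree ws (proj₁ (unb (suc i))) n (proj₂ (unb (suc i))) i<n)
    unb
    where
    -- The letter a only fills the positions beyond the end of a prefix.
    s : ωWord
    s i = (prefix ws (proj₁ (unb (suc i))) ++ω λ _ → a) i

  cofinally-nonempty⇒unbounded : ∀ {ws} → (∀ n → ∃[ i ] n ≤ i × ws i ≢ []) →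
                                 ∀ l → ∃[ n ] l ≤ length (prefix ws n)
  cofinally-nonempty⇒unbounded      ne zero    = 0 , z≤n
  cofinally-nonempty⇒unbounded {ws} ne (suc l) =
    let (n , l≤n)       = cofinally-nonempty⇒unbounded ne l
        (i , n≤i , wᵢ≢) = ne n
    in suc i , grow i (≤-trans l≤n (length-prefix-mono ws n≤i)) wᵢ≢
    where
    grow : ∀ i → l ≤ length (prefix ws i) → ws i ≢ [] → suc l ≤ length (prefix ws (suc i))
    grow i l≤i wᵢ≢
      rewrite prefix-suc ws i | length-++ (prefix ws i) {ws i} with ws i
    ... | []    = ⊥-elim (wᵢ≢ refl)
    ... | _ ∷ w rewrite +-suc (length (prefix ws i)) (length w) = s≤s (m≤n⇒m≤n+o _ l≤i)

  -- Either almost all factors are empty and the product is a finite word, or non-empty factors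
  -- recur forever and the prefixes grow without bound.
  ⇛-exists : ExcludedMiddle 0ℓ → ∀ ws → ∃[ x ] ws ⇛ x
  ⇛-exists em ws with em {∃[ n ] (∀ i → n ≤ i → ws i ≡ [])}
  ... | yes (n , e) = inj₁ (prefix ws n) , finite n e refl
  ... | no ¬e       = unbounded⇒⇛ (cofinally-nonempty⇒unbounded λ n →
    decidable-stable em λ none →
      ¬e (n , λ i n≤i → decidable-stable em λ wᵢ≢ → none (i , n≤i , wᵢ≢)))

module _ {m : ℕ} (𝔄 : ExtendedBüchi m) where

  open ExtendedBüchi 𝔄 using (states; q₀)
  open Abstraction 𝔄 renaming (+ to nonempty)
  open Endo (𝒫 𝒞) using (_^_)

  -- Linked pairs

  act-∈ : ∀ {w A} P {x} → w ≈ A → x ∈ ⟦ P ⟧ω → (w ++≤ω x) ∈ ⟦ act A P ⟧ω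
  act-∈ {w} (linked _ _ _ _) w≈A (c , y , c≈C , y∈ , x≈) =
    w ++ c , y , ++-cong w≈A c≈C , y∈ ,
    ≈ω.trans (++≤ω-cong w x≈) (≈ω.sym (++≤ω-assoc w c y))

  act-cong : ∀ {A A′} P → A ≈ A′ → act A P ≈₂ act A′ P
  act-cong (linked _ _ _ _) A≈A′ = ++-cong A≈A′ ≈-refl , ≈-refl

  prefix-absorb : ∀ {C D ws} → C ∙ D ≈ C → ws 0 ≈ C → (∀ i → ws (suc i) ≈ D) →
                  ∀ n → prefix ws (suc n) ≈ C
  prefix-absorb {ws = ws} CD=C w₀ w₊ zero =
    ≈-trans (≈-reflexive (++-identityʳ (ws 0))) w₀
  prefix-absorb {ws = ws} CD=C w₀ w₊ (suc n) =
    ≈-trans (≈-reflexive (prefix-suc ws (suc n)))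
      (≈-trans (++-cong (prefix-absorb {ws = ws} CD=C w₀ w₊ n) (w₊ n)) CD=C)

  -- The factorization of `x` is cut after a prefix covering `u`; the overhang beyond `u` starts the
  -- factorization of `v`.
  cut : ∀ P {x} u v → x ∈ ⟦ P ⟧ω → x ≈ω u ++≤ω v →
        ∃[ P′ ] P ≈₂ act u P′ × v ∈ ⟦ P′ ⟧ω
  cut (linked E D ED=E DD=D) u v (c , y , c≈E , (ds , ds≈D , ds⇛y) , x≈cy) x≈uv =
    -- The overhang `r` alone need not absorb `D`, but `r ∙ D` does, by `DD=D`.
    linked (r ∙ D) D
      (≈-trans (≈-reflexive (++-assoc r D D)) (++-cong (≈-refl {r}) DD=D)) DD=D ,
    (≈-sym u∙rD≈E , ≈-refl) ,
    r ++ ds N , z , ++-cong (≈-refl {r}) (ds≈D N) ,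
    (ds ∘ (suc N +_) , (λ i → ds≈D (suc N + i)) , proj₂ (proj₂ split)) ,
    ++≤ω-cancel u v _ (≈ω.trans (proj₁ (proj₂ split))
      (≈ω.trans (≈ω.reflexive (cong (_++≤ω z) prefix-2+N)) (++≤ω-assoc u _ z)))
    where
    open ≡-Reasoning

    ws : ℕ → Word
    ws zero    = c
    ws (suc i) = ds i

    ws⇛uv : ws ⇛ (u ++≤ω v)
    ws⇛uv = ⇛-resp (≈ω.trans (≈ω.sym x≈cy) x≈uv) (⇛-cons {ws = ws} ds⇛y)

    covered = ⇛-covers u v ws⇛uv
    N = proj₁ covered
    -- Including `ws N`, which is `c` if `N = 0`, ensures that the next factor is `ds N`, a word of
    -- `D`.
    r = proj₁ (proj₂ covered) ++ ws N

    prefix-1+N : prefix ws (suc N) ≡ u ++ r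
    prefix-1+N = begin
      prefix ws (suc N)      ≡⟨ prefix-suc ws N ⟩
      prefix ws N ++ ws N    ≡⟨ cong (_++ ws N) (proj₂ (proj₂ covered)) ⟩
      (u ++ _) ++ ws N       ≡⟨ ++-assoc u _ (ws N) ⟩
      u ++ r                 ∎

    prefix-2+N : prefix ws (2 + N) ≡ u ++ (r ++ ds N)
    prefix-2+N = begin
      prefix ws (2 + N)            ≡⟨ prefix-suc ws (suc N) ⟩
      prefix ws (suc N) ++ ds N    ≡⟨ cong (_++ ds N) prefix-1+N ⟩
      (u ++ r) ++ ds N             ≡⟨ ++-assoc u r (ds N) ⟩
      u ++ (r ++ ds N)             ∎

    split = ⇛-split (2 + N) ws⇛uv
    z = proj₁ split

    u∙rD≈E : u ∙ (r ∙ D) ≈ E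
    u∙rD≈E = ≈-trans (++-cong (≈-refl {u}) (++-cong (≈-refl {r}) (≈-sym (ds≈D N))))
      (≈-trans (≈-reflexive (sym prefix-2+N)) (prefix-absorb {ws = ws} ED=E c≈E ds≈D (suc N)))

  linked-nonempty : ExcludedMiddle 0ℓ → ∀ P → ∃[ x ] x ∈ ⟦ P ⟧ω
  linked-nonempty em P =
    let (y , ⇛y) = ⇛-exists em λ _ → snd P
    in fst P ++≤ω y , fst P , y , ≈-refl , (_ , (λ _ → ≈-refl) , ⇛y) , ≈ω.refl

  -- Ramsey factorizations

  prefix-cong : ∀ {us ws} → (∀ i → us i ≈ ws i) → ∀ n → prefix us n ≈ prefix ws n
  prefix-cong us≈ws zero    = ≈-refl
  prefix-cong us≈ws (suc n) = ++-cong (us≈ws 0) (prefix-cong (us≈ws ∘ suc) n)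

  -- Finitely many tests that determine the class of a word; the last separates the empty word from
  -- the others, which `∼` might fail to do.
  test : Fin 3 × State × State × ⊤ → Pred Word 0ℓ
  test (zero           , p , q , _) w = p ⇝[ w ] q
  test (suc zero       , p , q , _) w = p ⇝F[ w ] q
  test (suc (suc zero) , _ , _ , _) w = w ≡ []

  tests⇒≈ : ∀ {w u} → (∀ t → test t w ⇔ test t u) → w ≈ u
  tests⇒≈ {[]}    {[]}    eqv = ε
  tests⇒≈ {_ ∷ _} {_ ∷ _} eqv = nonempty λ p q →
    eqv (zero , p , q , tt) , eqv (suc zero , p , q , tt)
  tests⇒≈ {[]}    {_ ∷ _} eqv
    with () ← Equivalence.to (eqv (suc (suc zero) , q₀ , q₀ , tt)) refl
  tests⇒≈ {_ ∷ _} {[]}    eqv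
    with () ← Equivalence.from (eqv (suc (suc zero) , q₀ , q₀ , tt)) refl

  ramsey-≈ : ExcludedMiddle (lsuc 0ℓ) → (w : ℕ → ℕ → Word) →
             ∃[ h ] Increasing h ×
               (∀ {i j k l} → i < j → k < l → w (h i) (h j) ≈ w (h k) (h l))
  ramsey-≈ em w =
    let (h , inc , hom) =
          ramsey-Fin× em (ramsey-Fin× em (ramsey-Fin× em (ramsey-⊤ em) states) states) 3
            λ t i j → test t (w i j)
    in h , inc , λ i<j k<l → tests⇒≈ λ t → mk⇔ (hom t i<j k<l) (hom t k<l i<j)

  -- The pair is built from `ws` alone. Equivalent factors have equivalent segments, so the cut
  -- points found for `ws` serve every `us`.
  ramsey-linked : ExcludedMiddle (lsuc 0ℓ) → (ws : ℕ → Word) →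
                  ∃[ P ] (∀ us x → (∀ i → us i ≈ ws i) → us ⇛ x → x ∈ ⟦ P ⟧ω)
  ramsey-linked em ws = linked C D CD=C DD=D , contains
    where
    factorization = ramsey-≈ em (segment ws)
    h   = proj₁ factorization
    inc = proj₁ (proj₂ factorization)
    hom = proj₂ (proj₂ factorization)

    h≤ : ∀ {i j} → i ≤ j → h i ≤ h j
    h≤ = increasing⇒≤ inc

    C D : Word
    -- Stopping at `h 1` rather than `h 0` makes the prefix end in a segment of class `D`, so that
    -- it absorbs `D`.
    C = prefix ws (h 1)
    D = segment ws (h 0) (h 1)

    0<1 : 0 < 1
    0<1 = s≤s z≤n

    1<2 : 1 < 2
    1<2 = s≤s 0<1

    CD=C : C ∙ D ≈ C
    CD=C = ≈-trans (++-cong (≈-refl {C}) (hom 0<1 1<2))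
      (≈-trans (≈-reflexive (trans (prefix-segment ws (h≤ (s≤s z≤n)))
                                   (sym (prefix-segment ws (h≤ z≤n)))))
      (≈-trans (++-cong (≈-refl {prefix ws (h 0)}) (hom {0} {2} {0} {1} (s≤s z≤n) 0<1))
        (≈-reflexive (prefix-segment ws (h≤ z≤n)))))

    DD=D : D ∙ D ≈ D
    DD=D = ≈-trans (++-cong (≈-refl {D}) (hom 0<1 1<2))
      (≈-trans (≈-reflexive (segment-++ ws (h≤ z≤n) (h≤ (s≤s z≤n))))
        (hom {0} {2} {0} {1} (s≤s z≤n) 0<1))

    contains : ∀ us x → (∀ i → us i ≈ ws i) → us ⇛ x → x ∈ ⟦ linked C D CD=C DD=D ⟧ω
    contains us x us≈ws us⇛x =
      let (y , x≈ , rest⇛y) = ⇛-split (h 1) us⇛x in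
      prefix us (h 1) , y , prefix-cong us≈ws (h 1) ,
      (zs , zs≈D , ⇛-regroup (λ n → h (suc n) ∸ h 1) inflationary grouped rest⇛y) , x≈
      where
      zs : ℕ → Word
      zs n = segment us (h (1 + n)) (h (2 + n))

      zs≈D : ∀ n → zs n ≈ D
      zs≈D n = ≈-trans (prefix-cong (λ i → us≈ws (h (1 + n) + i)) (h (2 + n) ∸ h (1 + n)))
        (hom (n<1+n (1 + n)) 0<1)

      shift : ∀ n → n + h 1 ≤ h (suc n)
      shift zero    = ≤-refl
      shift (suc n) = ≤-<-trans (shift n) (inc (n<1+n (suc n)))

      inflationary : ∀ n → n ≤ h (suc n) ∸ h 1
      inflationary n = m+n≤o⇒m≤o∸n n (shift n)

      grouped : ∀ n → prefix zs n ≡ segment us (h 1) (h (suc n))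
      grouped zero    rewrite n∸n≡0 (h 1) = refl
      grouped (suc n) = trans (prefix-suc zs n)
        (trans (cong (_++ zs n) (grouped n))
          (segment-++ us (h≤ (s≤s z≤n)) (h≤ (n≤1+n (suc n)))))

  -- The closure operator

  α*-mono : ∀ {U U′} → U ⊆ U′ → α* U ⊆ α* U′
  α*-mono U⊆U′ C (w , w≈C , w∈U) = w , w≈C , U⊆U′ w w∈U

  𝔣-mono : ∀ {V V′} → V ⊆ V′ → 𝔣 V ⊆ 𝔣 V′
  𝔣-mono V⊆V′ P (x , x∈P , x∈V) = x , x∈P , V⊆V′ x x∈V

  𝔣𝔤-mono : ∀ {𝒱 𝒱′} → 𝒱 ⊆ 𝒱′ → 𝔣 (𝔤 𝒱) ⊆ 𝔣 (𝔤 𝒱′)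
  𝔣𝔤-mono {𝒱} {𝒱′} 𝒱⊆𝒱′ = 𝔣-mono {𝔤 𝒱} {𝔤 𝒱′} λ x (P , P∈𝒱 , x∈P) → P , 𝒱⊆𝒱′ P P∈𝒱 , x∈P

  𝔣𝔤^-mono : ∀ n {𝒱 𝒱′} → 𝒱 ⊆ 𝒱′ → ((𝔣 ∘ 𝔤) ^ n) 𝒱 ⊆ ((𝔣 ∘ 𝔤) ^ n) 𝒱′
  𝔣𝔤^-mono zero 𝒱⊆𝒱′ = 𝒱⊆𝒱′
  𝔣𝔤^-mono (suc n) {𝒱} {𝒱′} 𝒱⊆𝒱′ =
    𝔣𝔤-mono {((𝔣 ∘ 𝔤) ^ n) 𝒱} {((𝔣 ∘ 𝔤) ^ n) 𝒱′} (𝔣𝔤^-mono n 𝒱⊆𝒱′)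

  -- `_^_` unfolds at the outermost application, while (5) inserts its additional round innermost.
  𝔣𝔤^-suc : ∀ n 𝒱 → ((𝔣 ∘ 𝔤) ^ n) (𝔣 (𝔤 𝒱)) ⊆ ((𝔣 ∘ 𝔤) ^ suc n) 𝒱
  𝔣𝔤^-suc zero 𝒱 = λ _ → id
  𝔣𝔤^-suc (suc n) 𝒱 =
    𝔣𝔤-mono {((𝔣 ∘ 𝔤) ^ n) (𝔣 (𝔤 𝒱))} {((𝔣 ∘ 𝔤) ^ suc n) 𝒱} (𝔣𝔤^-suc n 𝒱)

  𝔠-mono : ∀ {𝒱 𝒱′} → 𝒱 ⊆ 𝒱′ → 𝔠 𝒱 ⊆ 𝔠 𝒱′
  𝔠-mono 𝒱⊆𝒱′ P (n , 1≤n , P∈) = n , 1≤n , 𝔣𝔤^-mono n 𝒱⊆𝒱′ P P∈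

  𝔣𝔤^-∅ : ∀ n P → ¬ P ∈ ((𝔣 ∘ 𝔤) ^ n) (𝔣 ∅)
  𝔣𝔤^-∅ zero    P (_ , _ , ())
  𝔣𝔤^-∅ (suc n) P (_ , _ , P′ , P′∈ , _) = 𝔣𝔤^-∅ n P′ P′∈

  -- Membership in an iterate is witnessed by a chain of words and pairs that goes back to a single
  -- word of `V ∪ V′`; the side of that word decides.
  𝔣𝔤^-∪ : ∀ V V′ n → ((𝔣 ∘ 𝔤) ^ n) (𝔣 (V ∪ V′)) ⊆
          ((𝔣 ∘ 𝔤) ^ n) (𝔣 V) ∪ ((𝔣 ∘ 𝔤) ^ n) (𝔣 V′)
  𝔣𝔤^-∪ V V′ zero    P (x , x∈P , inj₁ x∈V)  = inj₁ (x , x∈P , x∈V)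
  𝔣𝔤^-∪ V V′ zero    P (x , x∈P , inj₂ x∈V′) = inj₂ (x , x∈P , x∈V′)
  𝔣𝔤^-∪ V V′ (suc n) P (x , x∈P , P′ , P′∈ , x∈P′) with 𝔣𝔤^-∪ V V′ n P′ P′∈
  ... | inj₁ h = inj₁ (x , x∈P , P′ , h , x∈P′)
  ... | inj₂ h = inj₂ (x , x∈P , P′ , h , x∈P′)

  -- Prepending `w` to every word of a witnessing chain acts by `w` on all of its pairs.
  𝔣𝔤^-act⁺ : ∀ {U V w} → w ∈ U → ∀ n P → P ∈ ((𝔣 ∘ 𝔤) ^ n) (𝔣 V) →
             act w P ∈ ((𝔣 ∘ 𝔤) ^ n) (𝔣 (U ·≤ω V))
  𝔣𝔤^-act⁺ {w = w} w∈U zero P (x , x∈P , x∈V) =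
    w ++≤ω x , act-∈ P ≈-refl x∈P , w , x , w∈U , x∈V , ≈ω.refl
  𝔣𝔤^-act⁺ {U} {V} {w} w∈U (suc n) P (x , x∈P , P′ , P′∈ , x∈P′) =
    w ++≤ω x , act-∈ P ≈-refl x∈P ,
    act w P′ , 𝔣𝔤^-act⁺ {U} {V} w∈U n P′ P′∈ , act-∈ P′ ≈-refl x∈P′

  -- The word `w` split off at the start of the chain is kept in all later rounds, and each round
  -- cuts it off anew.
  𝔣𝔤^-act⁻ : ∀ {U V} n P → P ∈ ((𝔣 ∘ 𝔤) ^ n) (𝔣 (U ·≤ω V)) →
             ∃[ w ] ∃[ P′ ] w ∈ U × P′ ∈ ((𝔣 ∘ 𝔤) ^ n) (𝔣 V) × P ≈₂ act w P′
  𝔣𝔤^-act⁻ zero P (x , x∈P , u , v , u∈U , v∈V , x≈uv) =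
    let (P′ , P≈ , v∈P′) = cut P u v x∈P x≈uv
    in u , P′ , u∈U , (v , v∈P′ , v∈V) , P≈
  𝔣𝔤^-act⁻ {U} {V} (suc n) P (x , x∈P , R , R∈ , x∈R) =
    let (w , R′ , w∈U , R′∈ , R≈) = 𝔣𝔤^-act⁻ {U} {V} n R R∈
        -- x = e y with e ∈ w·fst R′ need not start with a word of U, but
        -- replacing e by w ++ fst R′ stays inside ⟦ P ⟧ω.
        (e , y , e≈ , y∈ , x≈ey) = ⟦⟧ω-cong R (act w R′) R≈ x x∈R
        (T , P≈eT , y∈T)         = cut P e y x∈P x≈ey
        z   = fst R′ ++≤ω y
        z∈P : (w ++≤ω z) ∈ ⟦ P ⟧ω
        z∈P = resp ⟦ P ⟧ω (++≤ω-assoc w (fst R′) y)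
          (⟦⟧ω-cong (act (w ++ fst R′) T) P
            (𝒞.trans {act (w ++ fst R′) T} {act e T} {P}
              (act-cong T (≈-sym e≈)) (𝒞.sym {P} {act e T} P≈eT)) _ (act-∈ T ≈-refl y∈T))
        (P′ , P≈ , z∈P′) = cut P w z z∈P ≈ω.refl
    in w , P′ , w∈U ,
       (z , z∈P′ , R′ , R′∈ , fst R′ , y , ≈-refl , y∈ , ≈ω.refl) , P≈
    where module 𝒞 = Setoid 𝒞

  -- The adjunction between α* and γ*

  α*-γ* : ∀ 𝒰 → α* (γ* 𝒰) ⊆ 𝒰
  α*-γ* 𝒰 C (w , w≈C , C′ , C′∈𝒰 , w≈C′) = resp 𝒰 (≈-trans (≈-sym w≈C′) w≈C) C′∈𝒰

  γ*-α* : ∀ U → U ⊆ γ* (α* U)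
  γ*-α* U w w∈U = w , (w , ≈-refl , w∈U) , ≈-refl

  ^ω-mono : ∀ {U U′} → U ⊆ U′ → U ^ω ⊆ U′ ^ω
  ^ω-mono U⊆U′ x (ws , ws∈U , ws⇛x) = ws , (λ i → U⊆U′ (ws i) (ws∈U i)) , ws⇛x

  𝔣-γ*α*^ω : ExcludedMiddle (lsuc 0ℓ) → ∀ U →
             𝔣 (γ* (α* U) ^ω) ⊆ 𝔣 (𝔤 (𝔣 (U ^ω)))
  𝔣-γ*α*^ω em U P (x , x∈P , ws , ws∈ , ws⇛x) =
    let (P′ , contains) = ramsey-linked em ws
        us i  = proj₁ (proj₁ (proj₂ (ws∈ i)))
        us∈U i = proj₂ (proj₂ (proj₁ (proj₂ (ws∈ i))))
        us≈ws i = ≈-trans (proj₁ (proj₂ (proj₁ (proj₂ (ws∈ i)))))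
                    (≈-sym (proj₂ (proj₂ (ws∈ i))))
        (y , us⇛y) = ⇛-exists (lower-em em) us
    -- `y` puts `P′` into `𝔣 (U ^ω)`, and `x` leads on from `P′` to `P`.
    in x , x∈P , P′ ,
       (y , contains us y us≈ws us⇛y , us , us∈U , us⇛y) ,
       contains ws x (λ _ → ≈-refl) ws⇛x

  α*-lfp : (em : ExcludedMiddle (lsuc 0ℓ)) → ∀ {n} Φ F →
           Monotone {n = n} Φ → Monotone {n = n} F →
           (∀ X → α* ∘ Φ X ≋ F (α* ∘ X)) →
           ∀ X Y → IsLfp Φ X → IsLfp F Y → α* ∘ X ≋ Y
  α*-lfp em Φ F Φ-mono F-mono comm X Y lfpX lfpY i =
    (λ C C∈ → α*-γ* (Y i) C (α*-mono {X i} {γ* (Y i)} (X⊑γY i) C C∈)) ,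
    αX-above i
    where
    αX-above : Y ⊑ α* ∘ X
    αX-above = KnasterTarski.isLfp-least-pre em F F-mono lfpY (α* ∘ X)
      λ j C C∈ → α*-mono {Φ X j} {X j} (proj₁ (proj₁ lfpX j)) C (proj₂ (comm X j) C C∈)

    X⊑γY : X ⊑ γ* ∘ Y
    -- The class of `w` lies in `α* (Φ (γ* Y)) = F (α* (γ* Y)) ⊆ F Y = Y`, with `w` as its own
    -- representative.
    X⊑γY = KnasterTarski.isLfp-least-pre em Φ Φ-mono lfpX (γ* ∘ Y) λ j w w∈ →
      w , proj₁ (proj₁ lfpY j) w
            (F-mono (λ k → α*-γ* (Y k)) j w
              (proj₁ (comm (γ* ∘ Y) j) w (w , ≈-refl , w∈))) , ≈-refl

theorem12 :
  -- classical metatheory (Ramsey for infinite words, impredicative lfp)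
  ExcludedMiddle (lsuc 0ℓ) →
  (m : ℕ) (𝔄 : ExtendedBüchi m) →
  let open Abstraction 𝔄 in
  -- (1)
  ( α* full ≐ full
  × pairs (α≤ω full) ≐ full
  × α* ∅ ≐ ∅
  × pairs (α≤ω ∅) ≐ ∅ )
  -- (2)
  × ( (∀ U U′ → α* (U ∪ U′) ≐ α* U ∪ α* U′)
    × (∀ V V′ → pairs (α≤ω (V ∪ V′)) ≐ pairs (α≤ω V) ∪ pairs (α≤ω V′)) )
  -- (3)
  × ( (∀ U U′ → α* (U · U′) ≐ α* U ·♯ α* U′)
    × (∀ U V → pairs (α≤ω (U ·≤ω V)) ≐ α* U ·♯≤ω α≤ω V) )
  -- (4)
  × ( (n : ℕ) → 1 ≤ n →
      (Φ : (Fin n → 𝒫 Σ*) → (Fin n → 𝒫 Σ*)) →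
      (F : (Fin n → M*) → (Fin n → M*)) →
      Monotone Φ → Monotone F →
      (∀ X → α* ∘ Φ X ≋ F (α* ∘ X)) →
      (∃[ X ] IsLfp Φ X) × (∃[ Y ] IsLfp F Y) ×
      (∀ X Y → IsLfp Φ X → IsLfp F Y → α* ∘ X ≋ Y) )
  -- (5)
  × (∀ U → pairs (α≤ω (U ^ω)) ≐ pairs (α* U ^ω♯))
theorem12 em m 𝔄 =
  ( ((λ _ _ → tt) , λ C _ → C , ≈-refl , tt)
  , ((λ _ _ → tt) , full⊆)
  , ((λ { _ (_ , _ , ()) }) , λ _ ())
  , ((λ P (n , _ , P∈) → 𝔣𝔤^-∅ 𝔄 n P P∈) , λ _ ()) ) ,
  ( (λ U U′ →
      (λ { C (w , w≈C , inj₁ w∈) → inj₁ (w , w≈C , w∈)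
         ; C (w , w≈C , inj₂ w∈) → inj₂ (w , w≈C , w∈) }) ,
      (λ { C (inj₁ (w , w≈C , w∈)) → w , w≈C , inj₁ w∈
         ; C (inj₂ (w , w≈C , w∈)) → w , w≈C , inj₂ w∈ }))
  , (λ V V′ →
      (λ P (n , 1≤n , P∈) → Sum.map (λ h → n , 1≤n , h) (λ h → n , 1≤n , h)
        (𝔣𝔤^-∪ 𝔄 V V′ n P P∈)) ,
      (λ { P (inj₁ h) → 𝔠-mono 𝔄 (𝔣-mono 𝔄 {V} {V ∪ V′} λ _ → inj₁) P h
         ; P (inj₂ h) → 𝔠-mono 𝔄 (𝔣-mono 𝔄 {V′} {V ∪ V′} λ _ → inj₂) P h })) ) ,
  ( (λ U U′ →
      (λ { C (_ , uu′≈C , u , u′ , u∈ , u′∈ , refl) →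
           u , u′ , (u , ≈-refl , u∈) , (u′ , ≈-refl , u′∈) , ≈-sym uu′≈C }) ,
      (λ { X (_ , _ , (u , u≈ , u∈) , (u′ , u′≈ , u′∈) , X≈) →
           u ++ u′ , ≈-trans (++-cong u≈ u′≈) (≈-sym X≈) , u , u′ , u∈ , u′∈ , refl }))
  , (λ U V →
      (λ P (n , 1≤n , P∈) →
        let (w , P′ , w∈U , P′∈ , P≈) = 𝔣𝔤^-act⁻ 𝔄 {U} {V} n P P∈
        in w , P′ , (w , ≈-refl , w∈U) , (n , 1≤n , P′∈) , P≈) ,
      (λ P (A , P′ , (w , w≈A , w∈U) , (n , 1≤n , P′∈) , P≈) →
        n , 1≤n , resp (((𝔣 ∘ 𝔤) ^ n) (𝔣 (U ·≤ω V)))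
          (𝒞.trans {act w P′} {act A P′} {P} (act-cong 𝔄 P′ w≈A) (𝒞.sym {P} {act A P′} P≈))
          (𝔣𝔤^-act⁺ 𝔄 {U} {V} w∈U n P′ P′∈))) ) ,
  (λ n _ Φ F Φ-mono F-mono comm →
    (_ , KnasterTarski.lfp-isLfp em Φ Φ-mono) ,
    (_ , KnasterTarski.lfp-isLfp em F F-mono) ,
    α*-lfp 𝔄 em Φ F Φ-mono F-mono comm) ,
  (λ U →
    𝔠-mono 𝔄 (𝔣-mono 𝔄 {U ^ω} {γ* (α* U) ^ω} (^ω-mono 𝔄 {U} {γ* (α* U)} (γ*-α* 𝔄 U))) ,
    (λ P (n , 1≤n , P∈) → suc n , s≤s z≤n ,
      𝔣𝔤^-suc 𝔄 n (𝔣 (U ^ω)) P (𝔣𝔤^-mono 𝔄 n (𝔣-γ*α*^ω 𝔄 em U) P P∈)))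
  where
  open Abstraction 𝔄
  open Endo (𝒫 𝒞) using (_^_)
  module 𝒞 = Setoid 𝒞

  full⊆ : full ⊆ pairs (α≤ω full)
  full⊆ P _ =
    -- One round suffices: the same `x` witnesses `P ∈ 𝔣 full` and leads from `P` back to `P`.
    let (x , x∈P) = linked-nonempty 𝔄 (lower-em em) P
    in 1 , s≤s z≤n , x , x∈P , P , (x , x∈P , tt) , x∈P
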